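{- Let $\mathbf{f} = (f_n)_{n\ge 1}$ be the ordinary paperfolding word over $\{0,1\}$, and let $\rho(n)$ denote its abelian complexity function (with $\rho(0)=1$). Then the sequence $(\rho(n))_{n\ge 0}$ is $2$-regular.
   Context: The ordinary paperfolding word $\mathbf{f}=(f_n)_{n\ge1}$ over $\{0,1\}$ is defined as follows: for $n\ge 1$ write $n=n'2^k$ with $n'$ odd; then $f_n=0$ if $n'\equiv 1 \pmod 4$ and $f_n=1$ if $n'\equiv 3\pmod 4$. Thus $\mathbf{f}=0010011000110110\cdots$. A factor of $\mathbf{f}$ is a finite contiguous block $f_i f_{i+1}\cdots f_{i+n-1}$. Two words $u,v$ over $\{0,1\}$ are abelian equivalent if one is a rearrangement of the other (equivalently, they have the same length and the same number of $0$'s). The abelian complexity $\rho(n)$ is the number of abelian equivalence classes among the factors of $\mathbf{f}$ of length $n$ (so $\rho(0)=1$). For an integer $k\ge2$ and an integer sequence $\mathbf{w}=(w(n))_{n\ge0}$, the $k$-kernel of $\mathbf{w}$ is the set of sequences $\{(w(k^e n+c))_{n\ge0} : e\ge0,\ 0\le c<k^e\}$; $\mathbf{w}$ is $k$-regular if the $\mathbb{Z}$-module generated by its $k$-kernel (together with the constant sequence $(1)_{n\ge0}$) is finitely generated. -}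

module Defs where

open import Data.Bool.Base using (if_then_else_)
open import Data.Fin.Base using (Fin)
open import Data.Fin.Patterns using (0F; 1F)
import Data.Fin.Properties as Fin
open import Data.Integer.Base as ℤ using (ℤ)
open import Data.List.Base
  using (List; []; _∷_; _++_; length; filter; deduplicate; allFin; cartesianProductWith)
import Data.List.Properties as List
open import Data.List.Membership.DecPropositional (Fin._≟_ {2}) using (_∈?_)
open import Data.List.Membership.Propositional.Properties using (∈-∃++)
open import Data.List.Relation.Binary.Permutation.Propositional
  using (_↭_; ↭-refl; ↭-sym; ↭-trans; prep)
open import Data.List.Relation.Binary.Permutation.Propositional.Properties
  using (shift; drop-∷; ∈-resp-↭; ¬x∷xs↭[])
open import Data.List.Relation.Unary.Any using (here)
open import Data.Nat.Base
open import Data.Nat.DivMod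
open import Data.Nat.Divisibility using (_∣_; divides; _∣?_)
open import Data.Nat.Induction using (<-rec)
open import Data.Nat.Properties
open import Data.Product.Base using (Σ; ∃; ∃₂; _×_; _,_; proj₁)
open import Data.Vec.Functional using (Vector)
open import Function.Base using (const; case_of_)
open import Function.Bundles using (_⇔_)
open import Level using (0ℓ)
open import Relation.Binary.Definitions using (Decidable)
open import Relation.Binary.PropositionalEquality
open import Relation.Nullary using (¬_; yes; no; contradiction)
open import Relation.Nullary.Decidable using (map′)
open import Relation.Unary using (Pred; _∪_)
import Relation.Unary as U
open import Data.Nat.Tactic.RingSolver using (solve-∀)

Letter : Set
Letter = Fin 2

Word : Set
Word = List Letter

oddDecomposition : ∀ n .{{_ : NonZero n}} → ∃₂ λ n′ k → n ≡ n′ * 2 ^ k × ¬ 2 ∣ n′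
oddDecomposition n {{nz}} = <-rec P step n nz
  where
  P : ℕ → Set
  P n = .(NonZero n) → ∃₂ λ n′ k → n ≡ n′ * 2 ^ k × ¬ 2 ∣ n′

  step : ∀ n → (∀ {m} → m < n → P m) → P n
  step n rec nz with 2 ∣? n
  ... | no 2∤n = n , 0 , sym (*-identityʳ n) , 2∤n
  ... | yes (divides zero refl) = contradiction refl (≢-nonZero⁻¹ 0 {{nz}})
  ... | yes (divides q@(suc _) refl) with rec (m<m*n q 2 (s≤s (s≤s z≤n))) _
  ...   | n′ , k , q≡ , odd = n′ , suc k , q*2≡ , odd
    where
    q*2≡ : q * 2 ≡ n′ * 2 ^ suc k
    q*2≡ = trans (cong (_* 2) q≡)
             (trans (*-assoc n′ (2 ^ k) 2) (cong (n′ *_) (*-comm (2 ^ k) 2)))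

-- Only used on odd arguments, so the second branch is the case n′ ≡ 3 (mod 4).
letter : ℕ → Letter
letter n′ = if n′ % 4 ≡ᵇ 1 then 0F else 1F

f : ∀ n .{{_ : NonZero n}} → Letter
f n = letter (proj₁ (oddDecomposition n))

block : ∀ i .{{_ : NonZero i}} → ℕ → Word
block i zero    = []
block i (suc n) = f i ∷ block (suc i) n

IsFactor : Pred Word 0ℓ
IsFactor u = ∃ λ i → u ≡ block (suc i) (length u)

-- Being a factor is decidable: a factor of length at most 2 ^ k already
-- occurs at one of the first 6 * 2 ^ k positions.

private
  odd-part-unique : ∀ m′ k n′ l → ¬ 2 ∣ m′ → ¬ 2 ∣ n′ →
                    m′ * 2 ^ k ≡ n′ * 2 ^ l → m′ ≡ n′
  odd-part-unique m′ zero n′ zero _ _ eq =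
    trans (sym (*-identityʳ m′)) (trans eq (*-identityʳ n′))
  odd-part-unique m′ zero n′ (suc l) odd _ eq =
    contradiction (subst (2 ∣_) (trans (sym eq) (*-identityʳ m′)) 2∣) odd
    where
    2∣ : 2 ∣ n′ * 2 ^ suc l
    2∣ = divides (n′ * 2 ^ l) (lem n′ (2 ^ l))
      where
      lem : ∀ a b → a * (2 * b) ≡ a * b * 2
      lem = solve-∀
  odd-part-unique m′ (suc k) n′ zero odd odd′ eq =
    sym (odd-part-unique n′ zero m′ (suc k) odd′ odd (sym eq))
  odd-part-unique m′ (suc k) n′ (suc l) odd odd′ eq =
    odd-part-unique m′ k n′ l odd odd′
      (*-cancelˡ-≡ _ _ 2 (trans (lem m′ (2 ^ k)) (trans eq (sym (lem n′ (2 ^ l))))))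
    where
    lem : ∀ a b → 2 * (a * b) ≡ a * (2 * b)
    lem = solve-∀

f-spec : ∀ n .{{_ : NonZero n}} n′ k → n ≡ n′ * 2 ^ k → ¬ 2 ∣ n′ → f n ≡ letter n′
f-spec n n′ k eq odd with oddDecomposition n
... | m′ , l , eq′ , odd′ =
  cong letter (odd-part-unique m′ l n′ k odd′ odd (trans (sym eq′) eq))

private
  F : ℕ → Letter
  F x = f (suc x)

  1+2m-odd : ∀ m → ¬ 2 ∣ 1 + m * 2
  1+2m-odd m (divides q eq) =
    case trans (sym ([m+kn]%n≡m%n 1 m 2)) (trans (cong (_% 2) eq) (m*n%n≡0 q 2)) of λ ()

  F-even : ∀ x → F (x * 2) ≡ letter (1 + x * 2)
  F-even x = f-spec (suc (x * 2)) _ 0 (sym (*-identityʳ _)) (1+2m-odd x)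

  F-odd : ∀ x → F (1 + x * 2) ≡ F x
  F-odd x with oddDecomposition (suc x)
  ... | n′ , k , eq , odd =
    f-spec (2 + x * 2) n′ (suc k) (trans (cong (_* 2) eq) (lem n′ (2 ^ k))) odd
    where
    lem : ∀ a b → a * b * 2 ≡ a * (2 * b)
    lem = solve-∀

  letter-cong : ∀ x y s → x % 2 ≡ y % 2 →
                letter (1 + (x + s) * 2) ≡ letter (1 + (y + s) * 2)
  letter-cong x y s eq = cong (λ r → if r ≡ᵇ 1 then 0F else 1F)
    (trans (red x) (trans (cong (λ r → (1 + (r + s) * 2) % 4) eq) (sym (red y))))
    where
    lem : ∀ r q s → 1 + (r + q * 2 + s) * 2 ≡ 1 + (r + s) * 2 + q * 4
    lem = solve-∀
    red : ∀ x → (1 + (x + s) * 2) % 4 ≡ (1 + (x % 2 + s) * 2) % 4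
    red x = trans
      (cong (_% 4) (trans (cong (λ z → 1 + (z + s) * 2) (m≡m%n+[m/n]*n x 2))
                          (lem (x % 2) (x / 2) s)))
      ([m+kn]%n≡m%n (1 + (x % 2 + s) * 2) (x / 2) 4)

  data Halves : ℕ → Set where
    even : ∀ m → Halves (m * 2)
    odd  : ∀ m → Halves (1 + m * 2)

  halves : ∀ n → Halves n
  halves zero = even 0
  halves (suc n) with halves n
  ... | even m = odd m
  ... | odd m  = even (suc m)

  half-< : ∀ {s} k → s * 2 < 2 ^ suc k → s < 2 ^ k
  half-< {s} k lt = *-cancelʳ-< 2 s (2 ^ k) (subst (s * 2 <_) (*-comm 2 (2 ^ k)) lt)

  double-< : ∀ {y} k → y < 6 * 2 ^ k → 1 + y * 2 < 6 * 2 ^ suc k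
  double-< {y} k lt = subst (2 + y * 2 ≤_) (lem (2 ^ k)) (*-monoˡ-≤ 2 lt)
    where
    lem : ∀ a → 6 * a * 2 ≡ 6 * (2 * a)
    lem = solve-∀

  +-double : ∀ x s → (x + s) * 2 ≡ x * 2 + s * 2
  +-double x s = *-distribʳ-+ 2 x s

  Early : ℕ → ℕ → Set
  Early k x = ∃ λ y → y < 6 * 2 ^ k × x % 2 ≡ y % 2 ×
                      (∀ t → t < 2 ^ k → F (x + t) ≡ F (y + t))

  early : ∀ k x → Early k x
  early zero x = base (x % 2) (F x) (m%n<n x 2) refl refl
    where
    found : ∀ y → y < 6 → x % 2 ≡ y % 2 → F x ≡ F y → Early 0 x
    found y lt par eq = y , lt , par , λ where
      zero _ → trans (cong F (+-identityʳ x)) (trans eq (cong F (sym (+-identityʳ y))))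
      (suc _) (s≤s ())
    base : ∀ r a → r < 2 → x % 2 ≡ r → F x ≡ a → Early 0 x
    base 0 0F _ = found 0 (≤ᵇ⇒≤ _ _ _)
    base 0 1F _ = found 2 (≤ᵇ⇒≤ _ _ _)
    base 1 0F _ = found 1 (≤ᵇ⇒≤ _ _ _)
    base 1 1F _ = found 5 (≤ᵇ⇒≤ _ _ _)
    base (suc (suc _)) _ (s≤s (s≤s ()))
  early (suc k) x with halves x
  ... | even x′ with early k x′
  ...   | y , lt , par , same =
    y * 2 , <⇒≤ (double-< k lt) , trans (m*n%n≡0 x′ 2) (sym (m*n%n≡0 y 2)) , go
    where
    at-even : ∀ x s → F (x * 2 + s * 2) ≡ letter (1 + (x + s) * 2)
    at-even x s = trans (cong F (sym (+-double x s))) (F-even (x + s))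
    at-odd : ∀ x s → F (x * 2 + (1 + s * 2)) ≡ F (x + s)
    at-odd x s = trans (cong F (trans (+-suc (x * 2) (s * 2)) (cong suc (sym (+-double x s)))))
                       (F-odd (x + s))
    go : ∀ t → t < 2 ^ suc k → F (x′ * 2 + t) ≡ F (y * 2 + t)
    go t t< with halves t
    ... | even s = trans (at-even x′ s) (trans (letter-cong x′ y s par) (sym (at-even y s)))
    ... | odd s  = trans (at-odd x′ s) (trans (same s (half-< k (<⇒≤ t<))) (sym (at-odd y s)))
  early (suc k) x | odd x′ with early k x′
  ...   | y , lt , par , same =
    1 + y * 2 , double-< k lt
    , trans ([m+kn]%n≡m%n 1 x′ 2) (sym ([m+kn]%n≡m%n 1 y 2)) , go
    where
    at-even : ∀ x s → F (1 + x * 2 + s * 2) ≡ F (x + s)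
    at-even x s = trans (cong (λ z → F (suc z)) (sym (+-double x s))) (F-odd (x + s))
    at-odd : ∀ x s → F (1 + x * 2 + (1 + s * 2)) ≡ letter (1 + (x + suc s) * 2)
    at-odd x s = trans (cong F (lem x s)) (F-even (x + suc s))
      where
      lem : ∀ x s → 1 + x * 2 + (1 + s * 2) ≡ (x + suc s) * 2
      lem = solve-∀
    go : ∀ t → t < 2 ^ suc k → F (1 + x′ * 2 + t) ≡ F (1 + y * 2 + t)
    go t t< with halves t
    ... | even s = trans (at-even x′ s) (trans (same s (half-< k t<)) (sym (at-even y s)))
    ... | odd s  = trans (at-odd x′ s) (trans (letter-cong x′ y (suc s) par) (sym (at-odd y s)))

  n<2^n : ∀ n → n < 2 ^ n
  n<2^n zero    = s≤s z≤n
  n<2^n (suc n) = ≤-trans (+-mono-≤ (≤-trans (s≤s z≤n) (n<2^n n)) (n<2^n n))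
                          (≤-reflexive (cong (2 ^ n +_) (sym (+-identityʳ (2 ^ n)))))

  block-cong : ∀ n x y → (∀ t → t < n → F (x + t) ≡ F (y + t)) →
               block (suc x) n ≡ block (suc y) n
  block-cong zero    x y same = refl
  block-cong (suc n) x y same = cong₂ _∷_
    (trans (cong F (sym (+-identityʳ x))) (trans (same 0 (s≤s z≤n)) (cong F (+-identityʳ y))))
    (block-cong n (suc x) (suc y) λ t t<n →
      trans (cong F (sym (+-suc x t))) (trans (same (suc t) (s≤s t<n)) (cong F (+-suc y t))))

isFactor? : U.Decidable IsFactor
isFactor? u = map′ (λ (i , _ , eq) → i , eq) bounded
  (anyUpTo? (λ i → List.≡-dec Fin._≟_ u (block (suc i) n)) (6 * 2 ^ n))
  where
  n = length u
  bounded : IsFactor u → ∃ λ i → i < 6 * 2 ^ n × u ≡ block (suc i) n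
  bounded (i , eq) with early n i
  ... | j , j< , _ , same = j , j< , trans eq
    (block-cong n i j λ t t<n → same t (<-trans t<n (n<2^n n)))

-- Abelian equivalence of words is _↭_.
infix 4 _↭?_

_↭?_ : Decidable (_↭_ {A = Letter})
[]       ↭? []       = yes ↭-refl
[]       ↭? (y ∷ ys) = no λ p → ¬x∷xs↭[] (↭-sym p)
(x ∷ xs) ↭? ys with x ∈? ys
... | no x∉ys = no λ p → x∉ys (∈-resp-↭ p (here refl))
... | yes x∈ys with ∈-∃++ x∈ys
...   | as , bs , refl = map′
  (λ p → ↭-trans (prep x p) (↭-sym (shift x as bs)))
  (λ p → drop-∷ (↭-trans p (shift x as bs)))
  (xs ↭? (as ++ bs))

words : ℕ → List Word
words zero    = [] ∷ []
words (suc n) = cartesianProductWith _∷_ (allFin 2) (words n)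

factors : ℕ → List Word
factors n = filter isFactor? (words n)

ρ : ℕ → ℕ
ρ n = length (deduplicate _↭?_ (factors n))

Sequence : Set
Sequence = ℕ → ℤ

-- The ℤ-submodule generated by S. Sequences are compared pointwise, hence
-- the closure under _≗_.
data Span (S : Pred Sequence 0ℓ) : Pred Sequence 0ℓ where
  gen   : ∀ {s} → S s → Span S s
  null  : Span S (const ℤ.0ℤ)
  add   : ∀ {s t} → Span S s → Span S t → Span S (λ n → s n ℤ.+ t n)
  scale : ∀ a {s} → Span S s → Span S (λ n → a ℤ.* s n)
  ext   : ∀ {s t} → s ≗ t → Span S s → Span S t

FinitelyGenerated : Pred Sequence 0ℓ → Set
FinitelyGenerated M =
  ∃ λ m → Σ (Vector Sequence m) λ g → ∀ s → M s ⇔ Span (λ t → ∃ λ i → t ≗ g i) s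

Kernel : ℕ → Sequence → Pred Sequence 0ℓ
Kernel k w s = ∃₂ λ e c → c < k ^ e × s ≗ (λ n → w (k ^ e * n + c))

IsRegular : ∀ k .{{_ : NonTrivial k}} → Sequence → Set
IsRegular k w = FinitelyGenerated (Span (Kernel k w ∪ (_≗ const ℤ.1ℤ)))

{-# OPTIONS --safe #-}

-- The excess of a letter in a window is the number of its occurrences minus
-- that of the other letter. Since f alternates on even positions and repeats
-- itself on odd ones, the excess of a window of length 2n or 2n + 1 is that of a
-- window of length n or n + 1 plus a term bounded by 1, which depends only on
-- parities. Hence the maximal excesses for the lengths n and n + 1, split by the
-- letter and by the parity of the starting position, are up to a common additive
-- constant one of twelve states of an automaton reading the binary digits of n.
-- Sliding a window changes the number of zeros by at most 1, so ρ(n) is 1 plus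
-- the maximal excess, and every linear relation between sequences ρ(2^e n + c)
-- only has to be checked on the twelve states.
module Submission where

open import Defs
open import Data.Integer.Base using (+_)
open import Data.Nat.Base

open import Data.Fin.Base using (Fin; zero; suc; toℕ; opposite)
open import Data.Fin.Patterns using (0F; 1F; 2F; 3F; 4F; 5F; 6F; 7F)
import Data.Fin.Properties as Fin
open import Data.Integer.Base as ℤ using (ℤ; 0ℤ; 1ℤ; -1ℤ; -[1+_])
import Data.Integer.Properties as ℤ
open import Data.Integer.Tactic.RingSolver using (solve-∀)
open import Data.List.Base
  using (List; []; _∷_; _++_; length; map; replicate; allFin; applyUpTo; deduplicate)
open import Data.List.Membership.Propositional using (_∈_; find; lose)
open import Data.List.Membership.Propositional.Properties
  using (∈-allFin; ∈-applyUpTo⁺; ∈-applyUpTo⁻; ∈-cartesianProductWith⁺; ∈-cartesianProductWith⁻;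
         ∈-filter⁺; ∈-filter⁻)
open import Data.List.Membership.Propositional.Properties.WithK using (unique∧set⇒bag)
import Data.List.Properties as List
open import Data.List.Relation.Binary.BagAndSetEquality using (∼bag⇒↭)
open import Data.List.Relation.Binary.Permutation.Propositional as ↭
  using (_↭_; refl; prep; swap; ↭-refl; ↭-sym; ↭-trans; ↭-reflexive; ↭-setoid; ↭-isEquivalence)
open import Data.List.Relation.Binary.Permutation.Propositional.Properties using (shift; ↭-length)
open import Data.List.Relation.Unary.Any using (here)
import Data.List.Relation.Unary.Any.Properties as Any
open import Data.List.Relation.Unary.Unique.DecSetoid.Properties using (deduplicate-!)
open import Data.List.Relation.Unary.Unique.Propositional using (Unique)
open import Data.List.Relation.Unary.Unique.Propositional.Properties using (applyUpTo⁺₁)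
import Data.List.Relation.Unary.Unique.Setoid.Properties as Uniqueₛ
open import Data.Nat.DivMod using (_%_; [m+kn]%n≡m%n; m*n%n≡0)
open import Data.Nat.Divisibility using (_∣_; divides)
open import Data.Nat.Induction using (<-rec)
open import Data.Nat.Properties hiding (_≟_)
import Data.Nat.Tactic.RingSolver as ℕ-Solver
open import Data.Product.Base using (∃; _×_; _,_; proj₁; proj₂)
open import Data.Sum.Base using (inj₁; inj₂)
open import Data.Vec.Functional using (Vector)
open import Function.Base using (const; _∘_)
open import Function.Bundles using (mk⇔)
open import Relation.Binary.PropositionalEquality
open import Relation.Nullary using (¬_; yes; no)
open import Relation.Nullary.Decidable using (toWitness)
open import Relation.Unary using (Pred; _∪_)

-- Paperfolding letters at even and odd positions.

-- The index shift puts the odd indices of `f`, where the letters alternate, at the even positions.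
F : ℕ → Letter
F x = f (suc x)

bit : Fin 2 → ℕ → ℕ
bit d n = toℕ d + n * 2

-- Landing in `Fin 2` lets parities double as letters and be ranged over in finite checks.
mod2 : ℕ → Fin 2
mod2 0             = 0F
mod2 1             = 1F
mod2 (suc (suc n)) = mod2 n

mod2-suc : ∀ n → mod2 (suc n) ≡ opposite (mod2 n)
mod2-suc 0             = refl
mod2-suc 1             = refl
mod2-suc (suc (suc n)) = mod2-suc n

mod2-bit : ∀ d n → mod2 (bit d n) ≡ d
mod2-bit 0F zero    = refl
mod2-bit 1F zero    = refl
mod2-bit 0F (suc n) = mod2-bit 0F n
mod2-bit 1F (suc n) = mod2-bit 1F n

bit-mod2-half : ∀ n → bit (mod2 n) ⌊ n /2⌋ ≡ n
bit-mod2-half 0             = refl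
bit-mod2-half 1             = refl
bit-mod2-half (suc (suc n)) =
  trans (+-suc (toℕ (mod2 n)) _)
        (cong suc (trans (+-suc (toℕ (mod2 n)) _) (cong suc (bit-mod2-half n))))

letter-mod2 : ∀ x → letter (1 + x * 2) ≡ mod2 x
letter-mod2 0             = refl
letter-mod2 1             = refl
letter-mod2 (suc (suc x)) = letter-mod2 x

1+2m-odd : ∀ m → ¬ 2 ∣ 1 + m * 2
1+2m-odd m (divides q eq)
  with () ← trans (sym ([m+kn]%n≡m%n 1 m 2)) (trans (cong (_% 2) eq) (m*n%n≡0 q 2))

F-even : ∀ x → F (x * 2) ≡ mod2 x
F-even x = trans (f-spec (suc (x * 2)) _ 0 (sym (*-identityʳ _)) (1+2m-odd x)) (letter-mod2 x)

F-odd : ∀ x → F (1 + x * 2) ≡ F x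
F-odd x with oddDecomposition (suc x)
... | n′ , k , eq , odd = f-spec (2 + x * 2) n′ (suc k)
  (trans (cong (_* 2) eq) (trans (*-assoc n′ (2 ^ k) 2) (cong (n′ *_) (*-comm (2 ^ k) 2)))) odd

-- Excesses of windows, split by the parity of positions.

sign : Letter → Letter → ℤ
sign 0F 0F = 1ℤ
sign 0F 1F = -1ℤ
sign 1F 0F = -1ℤ
sign 1F 1F = 1ℤ

excess : Letter → ℕ → ℕ → ℤ
excess a x zero    = 0ℤ
excess a x (suc n) = sign a (F x) ℤ.+ excess a (suc x) n

-- The excess in the word 0101..., which `F` reproduces along the even positions.
altExcess : Letter → ℕ → ℕ → ℤ
altExcess a x zero    = 0ℤ
altExcess a x (suc n) = sign a (mod2 x) ℤ.+ altExcess a (suc x) n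

-- Even positions `2j` of the window contribute `mod2 j`, odd positions `2j + 1` contribute `F j`.
-- The next three lemmas differ only in the first even position and in the two counts.
excess-even-even : ∀ a k n → excess a (k * 2) (n * 2) ≡ altExcess a k n ℤ.+ excess a k n
excess-even-even a k zero    = refl
excess-even-even a k (suc n)
  rewrite F-even k | F-odd k | excess-even-even a (suc k) n =
  lem (sign a (mod2 k)) (sign a (F k)) (altExcess a (suc k) n) (excess a (suc k) n)
  where
  lem : ∀ x y z w → x ℤ.+ (y ℤ.+ (z ℤ.+ w)) ≡ (x ℤ.+ z) ℤ.+ (y ℤ.+ w)
  lem = solve-∀

excess-odd-even : ∀ a k n → excess a (1 + k * 2) (n * 2) ≡ altExcess a (1 + k) n ℤ.+ excess a k n
excess-odd-even a k zero    = refl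
excess-odd-even a k (suc n)
  rewrite F-even (suc k) | F-odd k | excess-odd-even a (suc k) n =
  lem (sign a (F k)) (sign a (mod2 (suc k))) (altExcess a (2 + k) n) (excess a (suc k) n)
  where
  lem : ∀ x y z w → x ℤ.+ (y ℤ.+ (z ℤ.+ w)) ≡ (y ℤ.+ z) ℤ.+ (x ℤ.+ w)
  lem = solve-∀

excess-even-odd : ∀ a k n →
  excess a (k * 2) (1 + n * 2) ≡ altExcess a k (1 + n) ℤ.+ excess a k n
excess-even-odd a k n rewrite F-even k | excess-odd-even a k n =
  sym (ℤ.+-assoc (sign a (mod2 k)) _ _)

excess-odd-odd : ∀ a k n →
  excess a (1 + k * 2) (1 + n * 2) ≡ altExcess a (1 + k) n ℤ.+ excess a k (1 + n)
excess-odd-odd a k n rewrite F-odd k | excess-even-even a (suc k) n =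
  lem (sign a (F k)) (altExcess a (suc k) n) (excess a (suc k) n)
  where
  lem : ∀ x y z → x ℤ.+ (y ℤ.+ z) ≡ y ℤ.+ (x ℤ.+ z)
  lem = solve-∀

altExcess-shift₂ : ∀ a x n → altExcess a (2 + x) n ≡ altExcess a x n
altExcess-shift₂ a x zero    = refl
altExcess-shift₂ a x (suc n) = cong (ℤ._+_ (sign a (mod2 x))) (altExcess-shift₂ a (suc x) n)

sign-cancel : ∀ a b → sign a b ℤ.+ sign a (opposite b) ≡ 0ℤ
sign-cancel 0F 0F = refl
sign-cancel 0F 1F = refl
sign-cancel 1F 0F = refl
sign-cancel 1F 1F = refl

-- Neighbouring letters cancel, so at most one letter of the window counts.
altExcess-mod2 : ∀ a x n → altExcess a x n ≡ altExcess a x (toℕ (mod2 n))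
altExcess-mod2 a x 0 = refl
altExcess-mod2 a x 1 = refl
altExcess-mod2 a x (suc (suc n)) = begin
  s ℤ.+ (sign a (mod2 (suc x)) ℤ.+ altExcess a (2 + x) n)
    ≡⟨ cong₂ (λ b e → s ℤ.+ (sign a b ℤ.+ e)) (mod2-suc x) (altExcess-shift₂ a x n) ⟩
  s ℤ.+ (sign a (opposite (mod2 x)) ℤ.+ altExcess a x n)
    ≡⟨ ℤ.+-assoc s _ _ ⟨
  (s ℤ.+ sign a (opposite (mod2 x))) ℤ.+ altExcess a x n
    ≡⟨ cong (ℤ._+ altExcess a x n) (sign-cancel a (mod2 x)) ⟩
  0ℤ ℤ.+ altExcess a x n
    ≡⟨ ℤ.+-identityˡ _ ⟩
  altExcess a x n
    ≡⟨ altExcess-mod2 a x n ⟩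
  altExcess a x (toℕ (mod2 n)) ∎
  where
  open ≡-Reasoning
  s = sign a (mod2 x)

altExcess-periodic : ∀ a x j n → altExcess a (x + j * 2) n ≡ altExcess a x (toℕ (mod2 n))
altExcess-periodic a x zero    n rewrite +-identityʳ x = altExcess-mod2 a x n
altExcess-periodic a x (suc j) n rewrite +-suc x (1 + j * 2) | +-suc x (j * 2) =
  trans (altExcess-shift₂ a (x + j * 2) n) (altExcess-periodic a x j n)

-- Maxima over all positions and over one parity.

-- Attainment fixes the value, and the witness later supplies a window with the most zeros or the
-- most ones.
IsMax : (ℕ → ℤ) → ℤ → Set
IsMax g v = (∃ λ k → g k ≡ v) × (∀ k → g k ℤ.≤ v)

isMax-unique : ∀ {g u v} → IsMax g u → IsMax g v → u ≡ v
isMax-unique ((k , gk≡u) , ≤u) ((l , gl≡v) , ≤v) =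
  ℤ.≤-antisym (subst (ℤ._≤ _) gk≡u (≤v k)) (subst (ℤ._≤ _) gl≡v (≤u l))

-- The summand `c` stays outermost, so that it can be split off from the finite data of a state.
isMax-+ : ∀ {g h} c e v → (∀ k → h k ≡ e ℤ.+ g k) → IsMax g (c ℤ.+ v) → IsMax h (c ℤ.+ (e ℤ.+ v))
isMax-+ c e v h≡ ((k , gk≡) , ≤max) =
  (k , trans (h≡ k) (trans (cong (ℤ._+_ e) gk≡) (lem e c v))) ,
  λ l → subst₂ ℤ._≤_ (sym (h≡ l)) (lem e c v) (ℤ.+-monoʳ-≤ e (≤max l))
  where
  lem : ∀ x y z → x ℤ.+ (y ℤ.+ z) ≡ y ℤ.+ (x ℤ.+ z)
  lem = solve-∀

isMax-⊔ : ∀ {g} c u v →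
  IsMax (λ k → g (bit 0F k)) (c ℤ.+ u) → IsMax (λ k → g (bit 1F k)) (c ℤ.+ v) →
  IsMax g (c ℤ.+ (u ℤ.⊔ v))
isMax-⊔ {g} c u v ((k , gk≡) , ≤u) ((l , gl≡) , ≤v) = attained (ℤ.⊔-sel u v) , λ x →
  subst (λ z → g z ℤ.≤ _) (bit-mod2-half x) (bound (mod2 x) ⌊ x /2⌋)
  where
  attained : _ → ∃ λ k → g k ≡ c ℤ.+ (u ℤ.⊔ v)
  attained (inj₁ eq) = bit 0F k , trans gk≡ (cong (ℤ._+_ c) (sym eq))
  attained (inj₂ eq) = bit 1F l , trans gl≡ (cong (ℤ._+_ c) (sym eq))
  bound : ∀ p k → g (bit p k) ℤ.≤ c ℤ.+ (u ℤ.⊔ v)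
  bound 0F k = ℤ.≤-trans (≤u k) (ℤ.+-monoʳ-≤ c (ℤ.i≤i⊔j u v))
  bound 1F k = ℤ.≤-trans (≤v k) (ℤ.+-monoʳ-≤ c (ℤ.i≤j⊔i u v))

excessFrom : Letter → Fin 2 → ℕ → ℕ → ℤ
excessFrom a p n k = excess a (bit p k) n

-- The two arguments of the maximum belong to even and odd `k`, where the halved window starts at
-- `k` and its alternating part at `p + k`; `b` is the parity of the length of that part.
double : Letter → Fin 2 → Fin 2 → (Fin 2 → ℤ) → ℤ
double a p b m =
  (altExcess a (toℕ p) (toℕ b) ℤ.+ m 0F) ℤ.⊔ (altExcess a (suc (toℕ p)) (toℕ b) ℤ.+ m 1F)

-- Here `r` counts the even positions of a window of length `N`, and `n` the odd ones.
isMax-double : ∀ a p N r n {b} c m → mod2 r ≡ b →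
  (∀ k → excess a (bit p k) N ≡ altExcess a (toℕ p + k) r ℤ.+ excess a k n) →
  (∀ q → IsMax (excessFrom a q n) (c ℤ.+ m q)) →
  IsMax (excessFrom a p N) (c ℤ.+ double a p b m)
isMax-double a p N r n c m refl split max = isMax-⊔ c _ _
  (isMax-+ c (altExcess a (toℕ p) (toℕ (mod2 r))) (m 0F)
    (λ k → trans (split (k * 2))
      (cong (ℤ._+ excess a (k * 2) n) (altExcess-periodic a (toℕ p) k r)))
    (max 0F))
  (isMax-+ c (altExcess a (suc (toℕ p)) (toℕ (mod2 r))) (m 1F)
    (λ k → trans (split (1 + k * 2)) (cong (ℤ._+ excess a (1 + k * 2) n)
      (trans (cong (λ x → altExcess a x r) (+-suc (toℕ p) (k * 2)))
             (altExcess-periodic a (suc (toℕ p)) k r))))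
    (max 1F))

-- States and the action of a binary digit.

-- A state belongs to a length n: maxima i a p is the maximal excess of the letter a
-- over windows of length i + n starting at a position of parity p.
record State : Set where
  constructor ⟨_,_⟩
  field
    lengthParity : Fin 2
    maxima       : Fin 2 → Letter → Fin 2 → ℤ

open State

record Describes (n : ℕ) (c : ℤ) (s : State) : Set where
  field
    parityOf : mod2 n ≡ lengthParity s
    maximaOf : ∀ i a p → IsMax (excessFrom a p (toℕ i + n)) (c ℤ.+ maxima s i a p)

open Describes

evenMaxima : Fin 2 → (Letter → Fin 2 → ℤ) → Letter → Fin 2 → ℤ
evenMaxima b m a p = double a p b (m a)

-- A window of length `2n + 1` has `n + 1` even and `n` odd positions if it starts evenly, and the
-- reverse otherwise. This is why a state records two consecutive lengths.
oddMaxima : Fin 2 → (m m′ : Letter → Fin 2 → ℤ) → Letter → Fin 2 → ℤ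
oddMaxima b m m′ a 0F = double a 0F (opposite b) (m a)
oddMaxima b m m′ a 1F = double a 1F b (m′ a)

step : Fin 2 → State → State
step 0F ⟨ b , m ⟩ = ⟨ 0F , (λ { 0F → evenMaxima b (m 0F) ; 1F → oddMaxima b (m 0F) (m 1F) }) ⟩
step 1F ⟨ b , m ⟩ =
  -- The two lengths are now `2n + 1` and `2(n + 1)`; the latter halves to `n + 1`, whose parity is
  -- `opposite b`.
  ⟨ 1F , (λ { 0F → oddMaxima b (m 0F) (m 1F) ; 1F → evenMaxima (opposite b) (m 1F) }) ⟩

module _ {n c s} (d : Describes n c s) where
  private
    b = lengthParity s
    m = maxima s
    mod2-suc-n : mod2 (suc n) ≡ opposite b
    mod2-suc-n = trans (mod2-suc n) (cong opposite (parityOf d))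

  isMax-even : ∀ i {b} → mod2 (toℕ i + n) ≡ b → ∀ a p →
    IsMax (excessFrom a p ((toℕ i + n) * 2)) (c ℤ.+ evenMaxima b (m i) a p)
  isMax-even i eq a 0F =
    isMax-double a 0F (l * 2) l l c (m i a) eq (λ k → excess-even-even a k l) (maximaOf d i a)
    where l = toℕ i + n
  isMax-even i eq a 1F =
    isMax-double a 1F (l * 2) l l c (m i a) eq (λ k → excess-odd-even a k l) (maximaOf d i a)
    where l = toℕ i + n

  isMax-odd : ∀ a p → IsMax (excessFrom a p (1 + n * 2)) (c ℤ.+ oddMaxima b (m 0F) (m 1F) a p)
  isMax-odd a 0F =
    isMax-double a 0F (1 + n * 2) (1 + n) n c (m 0F a) mod2-suc-n
      (λ k → excess-even-odd a k n) (maximaOf d 0F a)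
  isMax-odd a 1F =
    isMax-double a 1F (1 + n * 2) n (1 + n) c (m 1F a) (parityOf d)
      (λ k → excess-odd-odd a k n) (maximaOf d 1F a)

  describes-step : ∀ e → Describes (bit e n) c (step e s)
  describes-step 0F .parityOf    = mod2-bit 0F n
  describes-step 0F .maximaOf 0F = isMax-even 0F (parityOf d)
  describes-step 0F .maximaOf 1F = isMax-odd
  describes-step 1F .parityOf    = mod2-bit 1F n
  describes-step 1F .maximaOf 0F = isMax-odd
  describes-step 1F .maximaOf 1F = isMax-even 1F mod2-suc-n

-- The twelve normal forms.

-- The maxima of the excess of 0F for (i , p) = (0 , 1), (1 , 0), (1 , 1), relative
-- to the one for (0 , 0).
shape : Fin 6 → ℤ × ℤ × ℤ
shape 0F = 0ℤ , 1ℤ , 1ℤ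
shape 1F = 0ℤ , -1ℤ , -1ℤ
shape 2F = 0ℤ , 1ℤ , -1ℤ
shape 3F = 0ℤ , -1ℤ , 1ℤ
shape 4F = + 2 , 1ℤ , 1ℤ
shape 5F = -[1+ 1 ] , -1ℤ , -1ℤ

shapeMaxima : ℤ × ℤ × ℤ → Fin 2 → Fin 2 → ℤ
shapeMaxima (x , y , z) 0F 0F = 0ℤ
shapeMaxima (x , y , z) 0F 1F = x
shapeMaxima (x , y , z) 1F 0F = y
shapeMaxima (x , y , z) 1F 1F = z

-- Reversing and complementing maps a window of length l starting at parity p
-- to one starting at parity p + l + 1, so the maxima for 1F mirror those for 0F.
mirror : Fin 2 → Letter → Fin 2 → Fin 2
mirror l 0F p  = p
mirror 0F 1F p = opposite p
mirror 1F 1F p = p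

normalForm : Fin 2 → Fin 6 → State
normalForm b q = ⟨ b , (λ i a p → shapeMaxima (shape q) i (mirror (mod2 (toℕ i + toℕ b)) a p)) ⟩

-- Every normal form is 0 at this entry, so the additive constant can be read off there.
offset : Fin 2 → Fin 2 → Fin 6 → ℤ
offset d b q = maxima (step d (normalForm b q)) 0F 0F 0F

-- The results of searches are abstract, lest with-abstraction unfold them.
abstract
  -- This closes the normal forms under both digits: apart from its constant, a state never carries
  -- more than `b` and `q`.
  step-normalForm : ∀ d b q → ∃ λ q′ → ∀ i a p →
    maxima (step d (normalForm b q)) i a p ≡
    offset d b q ℤ.+ maxima (normalForm d q′) i a p
  step-normalForm = toWitness {a? = Fin.all? λ d → Fin.all? λ b → Fin.all? λ q → Fin.any? λ q′ →
    Fin.all? λ i → Fin.all? λ a → Fin.all? λ p → _ ℤ.≟ _} _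

isMax-singleton : ∀ a p → IsMax (excessFrom a p 1) 1ℤ
isMax-singleton a p = attained a p , λ k → bound a (F (bit p k))
  where
  attained : ∀ a p → ∃ λ k → excessFrom a p 1 k ≡ 1ℤ
  -- `F` is `0F` at positions 0 and 1, and `1F` at positions 2 and 5.
  attained 0F 0F = 0 , refl
  attained 0F 1F = 0 , refl
  attained 1F 0F = 1 , refl
  attained 1F 1F = 2 , refl
  bound : ∀ a b → sign a b ℤ.+ 0ℤ ℤ.≤ 1ℤ
  bound = toWitness {a? = Fin.all? λ a → Fin.all? λ b → sign a b ℤ.+ 0ℤ ℤ.≤? 1ℤ} _

describes-zero : Describes 0 0ℤ (normalForm 0F 0F)
describes-zero .parityOf = refl
describes-zero .maximaOf = max
  where
  max : ∀ i a p → IsMax (excessFrom a p (toℕ i + 0)) (0ℤ ℤ.+ maxima (normalForm 0F 0F) i a p)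
  max 0F 0F 0F = (0 , refl) , λ _ → ℤ.≤-refl
  max 0F 0F 1F = (0 , refl) , λ _ → ℤ.≤-refl
  max 0F 1F 0F = (0 , refl) , λ _ → ℤ.≤-refl
  max 0F 1F 1F = (0 , refl) , λ _ → ℤ.≤-refl
  max 1F 0F 0F = isMax-singleton 0F 0F
  max 1F 0F 1F = isMax-singleton 0F 1F
  max 1F 1F 0F = isMax-singleton 1F 0F
  max 1F 1F 1F = isMax-singleton 1F 1F

describes-bit : ∀ {n c b q} d → Describes n c (normalForm b q) →
  ∃ λ c′ → ∃ λ q′ → Describes (bit d n) c′ (normalForm d q′)
describes-bit {n} {c} {b} {q} d D with step-normalForm d b q
... | q′ , eq = c ℤ.+ offset d b q , q′ , λ where
  .parityOf       → mod2-bit d n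
  .maximaOf i a p → subst (IsMax _)
    (trans (cong (ℤ._+_ c) (eq i a p))
      (sym (ℤ.+-assoc c (offset d b q) (maxima (normalForm d q′) i a p))))
    (maximaOf (describes-step D d) i a p)

Normal : ℕ → Set
Normal n = ∃ λ c → ∃ λ q → Describes n c (normalForm (mod2 n) q)

-- Strong induction removing the last binary digit; zero, its own half, is the base.
normal : ∀ n → Normal n
normal = <-rec Normal λ where
  zero    _   → 0ℤ , 0F , describes-zero
  (suc n) rec →
    let c , q , D    = rec (⌊n/2⌋<n n)
        c′ , q′ , D′ = describes-bit (mod2 (suc n)) D
    in c′ , q′ ,
       subst (λ m → Describes m c′ (normalForm (mod2 (suc n)) q′)) (bit-mod2-half (suc n)) D′

top : State → Letter → ℤ
top s a = maxima s 0F a 0F ℤ.⊔ maxima s 0F a 1F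

isMax-top : ∀ {n c s} → Describes n c s → ∀ a → IsMax (λ x → excess a x n) (c ℤ.+ top s a)
isMax-top {c = c} {s} D a =
  isMax-⊔ c (maxima s 0F a 0F) (maxima s 0F a 1F) (maximaOf D 0F a 0F) (maximaOf D 0F a 1F)

abstract
  -- Mirroring only permutes the two parities over which `top` maximises.
  top-symmetric : ∀ b q → top (normalForm b q) 0F ≡ top (normalForm b q) 1F
  top-symmetric = toWitness {a? = Fin.all? λ b → Fin.all? λ q →
    top (normalForm b q) 0F ℤ.≟ top (normalForm b q) 1F} _

-- The fewest zeros occur where the excess of `1F` is largest, so this ties the minimal zero count
-- to the maximal one.
isMax-swap : ∀ n {v} → IsMax (λ x → excess 0F x n) v → IsMax (λ x → excess 1F x n) v
isMax-swap n max with normal n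
... | c , q , D = subst (IsMax _)
  (trans (cong (ℤ._+_ c) (sym (top-symmetric (mod2 n) q))) (isMax-unique (isMax-top D 0F) max))
  (isMax-top D 1F)

-- Relations along strings of digits.

-- Most significant digit first.
append : List (Fin 2) → ℕ → ℕ
append []       n = n
append (d ∷ ds) n = append ds (bit d n)

run : List (Fin 2) → State → State
run []       s = s
run (d ∷ ds) s = run ds (step d s)

describes-run : ∀ ds {n c s} → Describes n c s → Describes (append ds n) c (run ds s)
describes-run []       D = D
describes-run (d ∷ ds) D = describes-run ds (describes-step D d)

-- Found by closing {ρ(n)} under n ↦ 2n and n ↦ 2n + 1 up to additive constants.
digits : Fin 8 → List (Fin 2)
digits 0F = []
digits 1F = 0F ∷ []
digits 2F = 1F ∷ []
digits 3F = 0F ∷ 1F ∷ []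
digits 4F = 1F ∷ 1F ∷ []
digits 5F = 1F ∷ 0F ∷ 1F ∷ []
digits 6F = 0F ∷ 1F ∷ 1F ∷ []
digits 7F = 1F ∷ 1F ∷ 1F ∷ []

abstract
  -- One pair `j`, `k` serves all twelve normal forms, so that the relation holds for every leading
  -- part `n`. Three values of `k` suffice.
  top-recurrence : ∀ i d → ∃ λ j → ∃ λ (k : Fin 3) → ∀ b q →
    top (run (d ∷ digits i) (normalForm b q)) 0F ≡
    + toℕ k ℤ.+ top (run (digits j) (normalForm b q)) 0F
  top-recurrence = toWitness {a? = Fin.all? λ i → Fin.all? λ d → Fin.any? λ j → Fin.any? λ k →
    Fin.all? λ b → Fin.all? λ q → _ ℤ.≟ _} _

-- Abelian classes of binary words.

zeros : Word → ℕ
zeros []       = 0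
zeros (0F ∷ u) = suc (zeros u)
zeros (1F ∷ u) = zeros u

zeros≤length : ∀ u → zeros u ≤ length u
zeros≤length []       = z≤n
zeros≤length (0F ∷ u) = s≤s (zeros≤length u)
zeros≤length (1F ∷ u) = m≤n⇒m≤1+n (zeros≤length u)

zeros-↭ : ∀ {u v} → u ↭ v → zeros u ≡ zeros v
zeros-↭ refl           = refl
zeros-↭ (prep 0F p)    = cong suc (zeros-↭ p)
zeros-↭ (prep 1F p)    = zeros-↭ p
zeros-↭ (swap 0F 0F p) = cong (λ z → suc (suc z)) (zeros-↭ p)
zeros-↭ (swap 0F 1F p) = cong suc (zeros-↭ p)
zeros-↭ (swap 1F 0F p) = cong suc (zeros-↭ p)
zeros-↭ (swap 1F 1F p) = zeros-↭ p
zeros-↭ (↭.trans p q)    = trans (zeros-↭ p) (zeros-↭ q)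

-- The canonical representative of an abelian class; truncated subtraction is harmless on `type u`,
-- as `zeros u ≤ length u`.
sorted : ℕ × ℕ → Word
sorted (l , z) = replicate z 0F ++ replicate (l ∸ z) 1F

type : Word → ℕ × ℕ
type u = length u , zeros u

↭-sorted : ∀ u → u ↭ sorted (type u)
↭-sorted []       = ↭-refl
↭-sorted (0F ∷ u) = prep 0F (↭-sorted u)
↭-sorted (1F ∷ u) rewrite +-∸-assoc 1 (zeros≤length u) =
  ↭-trans (prep 1F (↭-sorted u)) (↭-sym (shift 1F (replicate (zeros u) 0F) _))

type-↭ : ∀ {u v} → u ↭ v → type u ≡ type v
type-↭ p = cong₂ _,_ (↭-length p) (zeros-↭ p)

type-injective : ∀ {u v} → type u ≡ type v → u ↭ v
type-injective {u} {v} eq =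
  ↭-trans (↭-sorted u) (↭-trans (↭-reflexive (cong sorted eq)) (↭-sym (↭-sorted v)))

-- Sliding windows and the count of classes.

window : ℕ → ℕ → Word
window n x = block (suc x) n

length-window : ∀ n x → length (window n x) ≡ n
length-window zero    x = refl
length-window (suc n) x = cong suc (length-window n (suc x))

∈-words⁺ : ∀ u → u ∈ words (length u)
∈-words⁺ []      = here refl
∈-words⁺ (b ∷ u) = ∈-cartesianProductWith⁺ _∷_ (∈-allFin b) (∈-words⁺ u)

∈-words⁻ : ∀ n {u} → u ∈ words n → length u ≡ n
∈-words⁻ zero    (here refl) = refl
∈-words⁻ (suc n) u∈ with ∈-cartesianProductWith⁻ _∷_ (allFin 2) (words n) u∈
... | _ , _ , _ , v∈ , refl = cong suc (∈-words⁻ n v∈)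

∈-factors⁺ : ∀ n x → window n x ∈ factors n
∈-factors⁺ n x = ∈-filter⁺ isFactor?
  (subst (λ l → window n x ∈ words l) (length-window n x) (∈-words⁺ (window n x)))
  (x , cong (block (suc x)) (sym (length-window n x)))

∈-factors⁻ : ∀ n {u} → u ∈ factors n → ∃ λ x → u ≡ window n x
∈-factors⁻ n u∈ with ∈-filter⁻ isFactor? {xs = words n} u∈
... | u∈words , x , eq = x , trans eq (cong (block (suc x)) (∈-words⁻ n u∈words))

windowZeros : ℕ → ℕ → ℕ
windowZeros n x = zeros (window n x)

zeros-∷-≤ : ∀ b u → zeros (b ∷ u) ≤ suc (zeros u)
zeros-∷-≤ 0F u = ≤-refl
zeros-∷-≤ 1F u = n≤1+n _

zeros-≤-∷ : ∀ b u → zeros u ≤ zeros (b ∷ u)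
zeros-≤-∷ 0F u = n≤1+n _
zeros-≤-∷ 1F u = ≤-refl

zeros-∷-mono : ∀ b {u v} → zeros u ≤ zeros v → zeros (b ∷ u) ≤ zeros (b ∷ v)
zeros-∷-mono 0F le = s≤s le
zeros-∷-mono 1F le = le

-- The extra letter is the last one, while `block` unfolds at the front; hence the induction.
windowZeros-suc : ∀ n x → windowZeros n x ≤ windowZeros (suc n) x
windowZeros-suc zero    x = z≤n
windowZeros-suc (suc n) x =
  zeros-∷-mono (F x) {window n (suc x)} {window (suc n) (suc x)} (windowZeros-suc n (suc x))

windowZeros-suc-≤ : ∀ n x → windowZeros (suc n) x ≤ suc (windowZeros n x)
windowZeros-suc-≤ zero    x = zeros-∷-≤ (F x) []
windowZeros-suc-≤ (suc n) x with F x
... | 0F = s≤s (windowZeros-suc-≤ n (suc x))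
... | 1F = windowZeros-suc-≤ n (suc x)

module _ (g : ℕ → ℕ) (rise : ∀ x → g (suc x) ≤ suc (g x)) (fall : ∀ x → g x ≤ suc (g (suc x))) where

  private
    ascend : ∀ {c} k x → g x ≤ c → c ≤ g (k + x) → ∃ λ w → g w ≡ c
    ascend zero    x lo hi = x , ≤-antisym lo hi
    ascend {c} (suc k) x lo hi with c ≤? g (k + x)
    ... | yes le = ascend k x lo le
    ... | no ≰   = suc (k + x) , ≤-antisym (≤-trans (rise (k + x)) (≰⇒> ≰)) hi

    descend : ∀ {c} k x → c ≤ g x → g (k + x) ≤ c → ∃ λ w → g w ≡ c
    descend zero    x hi lo = x , ≤-antisym lo hi
    descend {c} (suc k) x hi lo with g (k + x) ≤? c
    ... | yes le = descend k x hi le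
    ... | no ≰   = suc (k + x) , ≤-antisym lo (s≤s⁻¹ (≤-trans (≰⇒> ≰) (fall (k + x))))

  -- Steps of size at most 1 cannot skip a value. Either endpoint may come first, hence the two
  -- directions.
  intermediateValue : ∀ x y {c} → g x ≤ c → c ≤ g y → ∃ λ w → g w ≡ c
  intermediateValue x y {c} lo hi with ≤-total x y
  ... | inj₁ x≤y = ascend (y ∸ x) x lo (subst (λ z → c ≤ g z) (sym (m∸n+n≡m x≤y)) hi)
  ... | inj₂ y≤x = descend (x ∸ y) y hi (subst (λ z → g z ≤ c) (sym (m∸n+n≡m y≤x)) lo)

-- The types of the classes and the pairs `(n , lo + i)` form duplicate-free lists with the same
-- members, so their lengths agree.
ρ-range : ∀ n x y → (∀ w → windowZeros n x ≤ windowZeros n w) →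
          (∀ w → windowZeros n w ≤ windowZeros n y) →
          ρ n ≡ suc (windowZeros n y ∸ windowZeros n x)
ρ-range n x y least greatest = begin
  length classes                    ≡⟨ List.length-map type classes ⟨
  length (map type classes)         ≡⟨ ↭-length (∼bag⇒↭ (unique∧set⇒bag unique unique′ (mk⇔ to from))) ⟩
  length (applyUpTo nth (suc size)) ≡⟨ List.length-applyUpTo nth (suc size) ⟩
  suc size                          ∎
  where
  open ≡-Reasoning
  lo   = windowZeros n x
  size = windowZeros n y ∸ lo
  nth : ℕ → ℕ × ℕ
  nth i = n , lo + i
  classes = deduplicate _↭?_ (factors n)

  unique : Unique (map type classes)
  unique = Uniqueₛ.map⁺ ↭-setoid (setoid (ℕ × ℕ)) type-injective
    (deduplicate-! record { isDecEquivalence = record { isEquivalence = ↭-isEquivalence ; _≟_ = _↭?_ } }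
      (factors n))

  unique′ : Unique (applyUpTo nth (suc size))
  unique′ = applyUpTo⁺₁ nth (suc size) λ i<j _ eq →
    <⇒≢ i<j (+-cancelˡ-≡ lo _ _ (cong proj₂ eq))

  to : ∀ {t} → t ∈ map type classes → t ∈ applyUpTo nth (suc size)
  to t∈ with find (Any.deduplicate⁻ _↭?_ (Any.map⁻ t∈))
  ... | u , u∈ , refl with ∈-factors⁻ n u∈
  ...   | w , refl = subst (_∈ applyUpTo nth (suc size))
    (cong₂ _,_ (sym (length-window n w)) (m+[n∸m]≡n (least w)))
    (∈-applyUpTo⁺ nth (s≤s (∸-monoˡ-≤ lo (greatest w))))

  from : ∀ {t} → t ∈ applyUpTo nth (suc size) → t ∈ map type classes
  from t∈ with ∈-applyUpTo⁻ nth t∈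
  -- Sliding by one passes through the window of length `suc n` at `w`, which contains both windows.
  ... | i , i< , refl with intermediateValue (windowZeros n)
          (λ w → ≤-trans (zeros-≤-∷ (F w) _) (windowZeros-suc-≤ n w))
          (λ w → ≤-trans (windowZeros-suc n w) (zeros-∷-≤ (F w) _))
          x y (m≤m+n lo i)
          (≤-trans (+-monoʳ-≤ lo (s≤s⁻¹ i<)) (≤-reflexive (m+[n∸m]≡n (least y))))
  -- Deduplication keeps one representative per class, so the property sought must be invariant
  -- under `_↭_`.
  ...   | w , eq = Any.map⁺ (Any.deduplicate⁺ _↭?_ (λ v↭u eq → trans eq (sym (type-↭ v↭u)))
    (lose (∈-factors⁺ n w) (sym (cong₂ _,_ (length-window n w) eq))))

-- Abelian complexity from the maximal excess.

excess-zeros : ∀ n x → excess 0F x n ≡ + (windowZeros n x * 2) ℤ.- + n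
excess-zeros zero    x = refl
excess-zeros (suc n) x with F x
... | 0F = trans (cong (ℤ._+_ 1ℤ) (excess-zeros n (suc x)))
                 (lem 1ℤ (+ (windowZeros n (suc x) * 2)) (+ n))
  where
  lem : ∀ o a b → o ℤ.+ (a ℤ.- b) ≡ (o ℤ.+ (o ℤ.+ a)) ℤ.- (o ℤ.+ b)
  lem = solve-∀
... | 1F = trans (cong (ℤ._+_ -1ℤ) (excess-zeros n (suc x)))
                 (lem 1ℤ (+ (windowZeros n (suc x) * 2)) (+ n))
  where
  lem : ∀ o a b → ℤ.- o ℤ.+ (a ℤ.- b) ≡ a ℤ.- (o ℤ.+ b)
  lem = solve-∀

excess-ones : ∀ n x → excess 1F x n ≡ + n ℤ.- + (windowZeros n x * 2)
excess-ones zero    x = refl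
excess-ones (suc n) x with F x
... | 0F = trans (cong (ℤ._+_ -1ℤ) (excess-ones n (suc x)))
                 (lem 1ℤ (+ (windowZeros n (suc x) * 2)) (+ n))
  where
  lem : ∀ o a b → ℤ.- o ℤ.+ (b ℤ.- a) ≡ (o ℤ.+ b) ℤ.- (o ℤ.+ (o ℤ.+ a))
  lem = solve-∀
... | 1F = trans (cong (ℤ._+_ 1ℤ) (excess-ones n (suc x)))
                 (lem 1ℤ (+ (windowZeros n (suc x) * 2)) (+ n))
  where
  lem : ∀ o a b → o ℤ.+ (b ℤ.- a) ≡ (o ℤ.+ b) ℤ.- a
  lem = solve-∀

-‿cancelʳ-≤ : ∀ a b c → a ℤ.- c ℤ.≤ b ℤ.- c → a ℤ.≤ b
-‿cancelʳ-≤ a b c le = subst₂ ℤ._≤_ (lem a c) (lem b c) (ℤ.+-monoˡ-≤ c le)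
  where
  lem : ∀ a c → (a ℤ.- c) ℤ.+ c ≡ a
  lem = solve-∀

-‿cancelˡ-≤ : ∀ c a b → c ℤ.- a ℤ.≤ c ℤ.- b → b ℤ.≤ a
-‿cancelˡ-≤ c a b le = subst₂ ℤ._≤_ (lem c a b) (lem′ c a b) (ℤ.+-monoˡ-≤ ((a ℤ.+ b) ℤ.- c) le)
  where
  lem : ∀ c a b → (c ℤ.- a) ℤ.+ ((a ℤ.+ b) ℤ.- c) ≡ b
  lem = solve-∀
  lem′ : ∀ c a b → (c ℤ.- b) ℤ.+ ((a ℤ.+ b) ℤ.- c) ≡ a
  lem′ = solve-∀

-- The largest excess of `0F` is `2 * hi - n` and that of `1F` is `n - 2 * lo`. Both equal `v`, so
-- their sum gives `hi - lo = v`.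
ρ-isMax : ∀ n {v} → IsMax (λ x → excess 0F x n) v → + ρ n ≡ 1ℤ ℤ.+ v
ρ-isMax n {v} max@((y , v≡) , ≤v) with isMax-swap n max
... | (x , v≡′) , ≤v′ = begin
  + ρ n            ≡⟨ cong +_ (ρ-range n x y least greatest) ⟩
  1ℤ ℤ.+ + (hi ∸ lo) ≡⟨ cong (ℤ._+_ 1ℤ) (ℤ.*-cancelʳ-≡ (+ (hi ∸ lo)) v (+ 2) doubled) ⟩
  1ℤ ℤ.+ v         ∎
  where
  open ≡-Reasoning
  lo = windowZeros n x
  hi = windowZeros n y

  greatest : ∀ w → windowZeros n w ≤ hi
  greatest w = *-cancelʳ-≤ (windowZeros n w) hi 2 (ℤ.drop‿+≤+
    (-‿cancelʳ-≤ (+ (windowZeros n w * 2)) (+ (hi * 2)) (+ n)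
      (subst₂ ℤ._≤_ (excess-zeros n w) (trans (sym v≡) (excess-zeros n y)) (≤v w))))

  least : ∀ w → lo ≤ windowZeros n w
  least w = *-cancelʳ-≤ lo (windowZeros n w) 2 (ℤ.drop‿+≤+
    (-‿cancelˡ-≤ (+ n) (+ (windowZeros n w * 2)) (+ (lo * 2))
      (subst₂ ℤ._≤_ (excess-ones n w) (trans (sym v≡′) (excess-ones n x)) (≤v′ w))))

  doubled : + (hi ∸ lo) ℤ.* + 2 ≡ v ℤ.* + 2
  doubled = begin
    + (hi ∸ lo) ℤ.* + 2  ≡⟨ ℤ.pos-* (hi ∸ lo) 2 ⟨
    + ((hi ∸ lo) * 2)    ≡⟨ cong +_ (*-distribʳ-∸ 2 hi lo) ⟩
    + (hi * 2 ∸ lo * 2)  ≡⟨ ℤ.⊖-≥ (*-monoˡ-≤ 2 (least y)) ⟨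
    (hi * 2) ℤ.⊖ (lo * 2) ≡⟨ ℤ.m-n≡m⊖n (hi * 2) (lo * 2) ⟨
    + (hi * 2) ℤ.- + (lo * 2) ≡⟨ lem (+ (hi * 2)) (+ (lo * 2)) (+ n) ⟩
    (+ (hi * 2) ℤ.- + n) ℤ.+ (+ n ℤ.- + (lo * 2))
      ≡⟨ cong₂ ℤ._+_ (trans (sym (excess-zeros n y)) v≡) (trans (sym (excess-ones n x)) v≡′) ⟩
    v ℤ.+ v              ≡⟨ double≡*2 v ⟩
    v ℤ.* + 2            ∎
    where
    lem : ∀ a b c → a ℤ.- b ≡ (a ℤ.- c) ℤ.+ (c ℤ.- b)
    lem = solve-∀
    double≡*2 : ∀ a → a ℤ.+ a ≡ a ℤ.* + 2
    double≡*2 a = trans (cong₂ ℤ._+_ (sym (ℤ.*-identityʳ a)) (sym (ℤ.*-identityʳ a)))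
                        (sym (ℤ.*-distribˡ-+ a 1ℤ 1ℤ))

ρ-append : ∀ ds {n c s} → Describes n c s → + ρ (append ds n) ≡ 1ℤ ℤ.+ (c ℤ.+ top (run ds s) 0F)
ρ-append ds {n} D = ρ-isMax (append ds n) (isMax-top (describes-run ds D) 0F)

-- The constant `c` of `n` enters both sides alike, so the relation between states carries over to
-- `ρ`.
ρ-recurrence : ∀ i d → ∃ λ j → ∃ λ k → ∀ n →
  + ρ (append (digits i) (bit d n)) ≡ k ℤ.+ + ρ (append (digits j) n)
ρ-recurrence i d = j , + toℕ k , λ n → shifted n (normal n)
  where
  j  = proj₁ (top-recurrence i d)
  k  = proj₁ (proj₂ (top-recurrence i d))
  eq = proj₂ (proj₂ (top-recurrence i d))
  open ≡-Reasoning
  lem : ∀ o c k t → o ℤ.+ (c ℤ.+ (k ℤ.+ t)) ≡ k ℤ.+ (o ℤ.+ (c ℤ.+ t))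
  lem = solve-∀
  shifted : ∀ n → Normal n →
    + ρ (append (digits i) (bit d n)) ≡ + toℕ k ℤ.+ + ρ (append (digits j) n)
  shifted n (c , q , D) = begin
    + ρ (append (digits i) (bit d n))
      ≡⟨ ρ-append (d ∷ digits i) D ⟩
    1ℤ ℤ.+ (c ℤ.+ top (run (d ∷ digits i) s) 0F)
      ≡⟨ cong (λ t → 1ℤ ℤ.+ (c ℤ.+ t)) (eq (mod2 n) q) ⟩
    1ℤ ℤ.+ (c ℤ.+ (+ toℕ k ℤ.+ top (run (digits j) s) 0F))
      ≡⟨ lem 1ℤ c (+ toℕ k) (top (run (digits j) s) 0F) ⟩
    + toℕ k ℤ.+ (1ℤ ℤ.+ (c ℤ.+ top (run (digits j) s) 0F))
      ≡⟨ cong (ℤ._+_ (+ toℕ k)) (ρ-append (digits j) D) ⟨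
    + toℕ k ℤ.+ + ρ (append (digits j) n) ∎
    where s = normalForm (mod2 n) q

-- Finite generation of the kernel module.

generator : Vector Sequence 9
generator 0F      = const 1ℤ
generator (suc i) = λ n → + ρ (append (digits i) n)

Generator : Pred Sequence _
Generator t = ∃ λ i → t ≗ generator i

span-bind : ∀ {S T : Pred Sequence _} → (∀ {s} → S s → Span T s) → ∀ {s} → Span S s → Span T s
span-bind h (gen Ss)    = h Ss
span-bind h null        = null
span-bind h (add x y)   = add (span-bind h x) (span-bind h y)
span-bind h (scale a x) = scale a (span-bind h x)
span-bind h (ext eq x)  = ext eq (span-bind h x)

-- Composition with `bit d` is linear, so only generators matter; the constant sequence absorbs the
-- `k` of the recurrence.
span-bit : ∀ d {s} → Span Generator s → Span Generator (s ∘ bit d)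
span-bit d (gen (zero , eq)) = gen (zero , λ n → eq (bit d n))
span-bit d (gen (suc i , eq)) =
  let j , k , rec = ρ-recurrence i d
  in ext (λ n → sym (trans (eq (bit d n)) (trans (rec n)
           (cong (ℤ._+ + ρ (append (digits j) n)) (sym (ℤ.*-identityʳ k))))))
         (add (scale k (gen (zero , λ _ → refl))) (gen (suc j , λ _ → refl)))
span-bit d null        = null
span-bit d (add x y)   = add (span-bit d x) (span-bit d y)
span-bit d (scale a x) = scale a (span-bit d x)
span-bit d (ext eq x)  = ext (λ n → eq (bit d n)) (span-bit d x)

-- The leading binary digit `d` of `c`, found by comparison with `2 ^ e`, is the one next to `n`:
-- `2 ^ suc e * n + c` is `2 ^ e * bit d n` plus the rest of `c`.
kernel-span : ∀ e c → c < 2 ^ e → Span Generator (λ n → + ρ (2 ^ e * n + c))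
kernel-span zero zero _ =
  gen (1F , λ n → cong (λ m → + ρ m) (trans (+-identityʳ (1 * n)) (*-identityˡ n)))
kernel-span zero (suc c) (s≤s ())
kernel-span (suc e) c c< with c <? 2 ^ e
... | yes c<2^e = ext (λ n → cong (λ m → + ρ m) (lem (2 ^ e) n c))
                      (span-bit 0F (kernel-span e c c<2^e))
  where
  lem : ∀ x n c → x * (n * 2) + c ≡ 2 * x * n + c
  lem = ℕ-Solver.solve-∀
... | no c≮2^e = ext
  (λ n → cong (λ m → + ρ m) (trans (lem (2 ^ e) n (c ∸ 2 ^ e))
    (cong (_+_ (2 * 2 ^ e * n)) (m+[n∸m]≡n 2^e≤c))))
  (span-bit 1F (kernel-span e (c ∸ 2 ^ e)
    (+-cancelˡ-< (2 ^ e) _ _ (subst₂ _<_ (sym (m+[n∸m]≡n 2^e≤c))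
      (cong (_+_ (2 ^ e)) (+-identityʳ (2 ^ e))) c<))))
  where
  2^e≤c = ≮⇒≥ c≮2^e
  lem : ∀ x n c → x * (1 + n * 2) + c ≡ 2 * x * n + (x + c)
  lem = ℕ-Solver.solve-∀

-- This places the generators inside the kernel, for the converse inclusion.
append-affine : ∀ ds → ∃ λ c → c < 2 ^ length ds × (∀ n → append ds n ≡ 2 ^ length ds * n + c)
append-affine []       = 0 , s≤s z≤n , λ n → sym (trans (+-identityʳ (1 * n)) (*-identityˡ n))
append-affine (d ∷ ds) with append-affine ds
... | c , c< , eq = x * toℕ d + c , bound d , λ n → trans (eq (bit d n)) (lem x (toℕ d) n c)
  where
  x = 2 ^ length ds
  lem : ∀ x d n c → x * (d + n * 2) + c ≡ 2 * x * n + (x * d + c)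
  lem = ℕ-Solver.solve-∀
  bound : ∀ d → x * toℕ d + c < 2 * x
  bound d = begin-strict
    x * toℕ d + c <⟨ +-mono-≤-< (*-monoʳ-≤ x (s≤s⁻¹ (Fin.toℕ<n d))) c< ⟩
    x * 1 + x     ≡⟨ lem′ x ⟩
    2 * x         ∎
    where
    open ≤-Reasoning
    lem′ : ∀ x → x * 1 + x ≡ 2 * x
    lem′ = ℕ-Solver.solve-∀

theorem1 : IsRegular 2 (λ n → + (ρ n))
theorem1 = 9 , generator , λ s → mk⇔ (span-bind from-kernel) (span-bind to-kernel)
  where
  Kernel₁ = Kernel 2 (λ n → + ρ n) ∪ (_≗ const 1ℤ)

  from-kernel : ∀ {s} → Kernel₁ s → Span Generator s
  from-kernel (inj₁ (e , c , c< , eq)) = ext (λ n → sym (eq n)) (kernel-span e c c<)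
  from-kernel (inj₂ eq)                = gen (zero , eq)

  to-kernel : ∀ {s} → Generator s → Span Kernel₁ s
  to-kernel (zero  , eq) = gen (inj₂ eq)
  to-kernel (suc i , eq) =
    let c , c< , affine = append-affine (digits i)
    in gen (inj₁ (length (digits i) , c , c< , λ n → trans (eq n) (cong (λ m → + ρ m) (affine n))))
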